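{- Let $f:D\to\{0,1\}$, $D\subseteq\{0,1\}^n$, be a non-constant $n$-bit partial Boolean function. Then $f$ can be computed exactly by a quantum 1-query algorithm if and only if there exists a degree-1 SOS complex representation matrix $A$ of $f$ and $\bar f$ such that $A^\dagger A=\mathrm{diag}(u_0,u_1,\dots,u_n)$ for some numbers $u_0,\dots,u_n$ (i.e. the $n+1$ columns of $A$ are pairwise orthogonal).
   Context: An $n$-bit partial Boolean function is a map $f:D\to\{0,1\}$ with $D\subseteq\{0,1\}^n$; $\bar f(x)=1\oplus f(x)$ on $D$. For $x\in\{0,1\}^n$, $|F(x)\rangle_1=(1,(-1)^{x_1},\dots,(-1)^{x_n})^T$. A degree-1 SOS complex representation matrix of $f$ and $\bar f$ is a $(p+q)\times(n+1)$ complex matrix $A$ with rows $a^1,\dots,a^{p+q}\in\mathbb{C}^{n+1}$ (row vectors; columns indexed by $\emptyset,\{1\},\dots,\{n\}$) such that: $f(x)=\sum_{l=1}^p|a^l|F(x)\rangle_1|^2$ for all $x\in D$; $\sum_{l=1}^{p+q}|a^l|F(x)\rangle_1|^2=1$ for all $x\in\{0,1\}^n$; and hence $\bar f(x)=\sum_{l=p+1}^{p+q}|a^l|F(x)\rangle_1|^2$ for all $x\in D$. A quantum 1-query algorithm works in a finite-dimensional Hilbert space with orthonormal basis $\{|i,j'\rangle\}$, $i\in\{0,\dots,n\}$; the oracle is $O_x|i,j'\rangle=(-1)^{x_i}|i,j'\rangle$ for $i\ge 1$, $O_x|0,j'\rangle=|0,j'\rangle$; the algorithm applies input-independent unitaries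 $U_0,O_x,U_1$ to an initial state and performs a projective measurement with outcomes in $\{0,1\}$; it computes $f$ exactly if for every $x\in D$ the outcome is $f(x)$ with probability 1. -}

module Defs where

open import Algebra.Bundles using (CommutativeRing; RawRing)
import Algebra.Definitions.RawMonoid as RawMonoidDefinitions
open import Data.Bool using (Bool; true; false; if_then_else_)
open import Data.Fin using (Fin; zero; suc; _↑ˡ_; quotient)
open import Data.Fin.Properties using (_≟_)
open import Data.Nat using (ℕ; suc)
import Data.Nat as ℕ
open import Data.Product using (∃; ∃-syntax; _×_)
open import Data.Vec using (Vec; lookup)
open import Data.Vec.Functional using (Vector)
open import Level using (0ℓ)
open import Relation.Binary using (Rel; IsDecTotalOrder)
open import Relation.Binary.PropositionalEquality using (_≡_; _≢_)
open import Relation.Nullary using (¬_; does)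
open import Relation.Unary using (Pred; _∈_)

-- The real numbers, characterised (up to isomorphism) as a Dedekind-complete
-- ordered field.  The order is decidable and suprema exist for arbitrary
-- predicates: this is the classical ℝ.
record CompleteOrderedField : Set₁ where
  infix 4 _≤_
  field
    commutativeRing : CommutativeRing 0ℓ 0ℓ
  open CommutativeRing commutativeRing public
  field
    _≤_             : Rel Carrier 0ℓ
    isDecTotalOrder : IsDecTotalOrder _≈_ _≤_
    0≉1             : ¬ 0# ≈ 1#
    inverse         : ∀ x → ¬ x ≈ 0# → ∃[ y ] x * y ≈ 1#
    +-monoˡ-≤       : ∀ {x y} z → x ≤ y → x + z ≤ y + z
    *-nonNeg        : ∀ {x y} → 0# ≤ x → 0# ≤ y → 0# ≤ x * y

  IsUpperBound : Pred Carrier 0ℓ → Pred Carrier 0ℓ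
  IsUpperBound P b = ∀ x → x ∈ P → x ≤ b

  field
    supremum : (P : Pred Carrier 0ℓ) → ∃ P → ∃ (IsUpperBound P) →
               ∃[ s ] IsUpperBound P s × (∀ b → IsUpperBound P b → s ≤ b)

BitString : ℕ → Set
BitString = Vec Bool

record PartialBooleanFunction (n : ℕ) : Set₁ where
  field
    domain : Pred (BitString n) 0ℓ
    value  : (x : BitString n) → .(x ∈ domain) → Bool

NonConstant : ∀ {n} → PartialBooleanFunction n → Set
NonConstant f = ¬ (∃[ b ] (∀ x (x∈D : x ∈ domain) → value x x∈D ≡ b))
  where open PartialBooleanFunction f

module Over (ℝ : CompleteOrderedField) where

  private module ℝ = CompleteOrderedField ℝ

  infix 6 _+i_
  record ℂ : Set where
    constructor _+i_
    field
      re im : ℝ.Carrier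
  open ℂ public

  ℂ-rawRing : RawRing 0ℓ 0ℓ
  ℂ-rawRing = record
    { Carrier = ℂ
    ; _≈_     = λ z w → (re z ℝ.≈ re w) × (im z ℝ.≈ im w)
    ; _+_     = λ z w → (re z ℝ.+ re w) +i (im z ℝ.+ im w)
    ; _*_     = λ z w → (re z ℝ.* re w ℝ.- im z ℝ.* im w)
                     +i (re z ℝ.* im w ℝ.+ im z ℝ.* re w)
    ; -_      = λ z → (ℝ.- re z) +i (ℝ.- im z)
    ; 0#      = ℝ.0# +i ℝ.0#
    ; 1#      = ℝ.1# +i ℝ.0#
    }

  open RawRing ℂ-rawRing public
    using (_≈_; _+_; _*_; -_; 0#; 1#; +-rawMonoid)

  conj : ℂ → ℂ
  conj z = re z +i (ℝ.- im z)

  ∣_∣² : ℂ → ℝ.Carrier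
  ∣ z ∣² = re z ℝ.* re z ℝ.+ im z ℝ.* im z

  open RawMonoidDefinitions +-rawMonoid public
    using () renaming (sum to ∑ℂ)
  open RawMonoidDefinitions ℝ.+-rawMonoid public
    using () renaming (sum to ∑ℝ)

  Matrix : ℕ → ℕ → Set
  Matrix m n = Fin m → Fin n → ℂ

  infix 4 _≋_
  _≋_ : ∀ {m n} → Matrix m n → Matrix m n → Set
  A ≋ B = ∀ i j → A i j ≈ B i j

  infixl 6 _⊕_
  _⊕_ : ∀ {m n} → Matrix m n → Matrix m n → Matrix m n
  (A ⊕ B) i j = A i j + B i j

  infixl 7 _⊡_
  _⊡_ : ∀ {m n k} → Matrix m n → Matrix n k → Matrix m k
  (A ⊡ B) i k = ∑ℂ (λ j → A i j * B j k)

  infixr 7 _·_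
  _·_ : ∀ {m n} → Matrix m n → Vector ℂ n → Vector ℂ m
  (A · v) i = ∑ℂ (λ j → A i j * v j)

  infixl 8 _†
  _† : ∀ {m n} → Matrix m n → Matrix n m
  (A †) i j = conj (A j i)

  diag : ∀ {n} → Vector ℂ n → Matrix n n
  diag u i j = if does (i ≟ j) then u i else 0#

  𝟘 𝟙 : ∀ {n} → Matrix n n
  𝟘 _ _ = 0#
  𝟙 = diag (λ _ → 1#)

  ‖_‖² : ∀ {n} → Vector ℂ n → ℝ.Carrier
  ‖ v ‖² = ∑ℝ (λ i → ∣ v i ∣²)

  record IsUnitary {n} (U : Matrix n n) : Set where
    field
      †-inverseˡ : U † ⊡ U ≋ 𝟙
      †-inverseʳ : U ⊡ U † ≋ 𝟙

  record IsProjectiveMeasurement {n} (P : Bool → Matrix n n) : Set where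
    field
      hermitian  : ∀ b → P b † ≋ P b
      idempotent : ∀ b → P b ⊡ P b ≋ P b
      orthogonal : ∀ {b c} → b ≢ c → P b ⊡ P c ≋ 𝟘
      complete   : P false ⊕ P true ≋ 𝟙

  -- The vector |F(x)⟩₁ = (1, (-1)^x₁, …, (-1)^xₙ); its entries are also the
  -- phases applied by the oracle.  Index zero stands for ∅ (no query), and
  -- suc i for the i-th bit.
  ∣F⟩ : ∀ {n} → BitString n → Vector ℂ (suc n)
  ∣F⟩ x zero    = 1#
  ∣F⟩ x (suc i) = if lookup x i then - 1# else 1#

  -- The space with basis |i,j⟩, i : Fin (suc n), j : Fin m, is ℂ^((n+1)·m),
  -- where |i,j⟩ has index `combine i j`; so `quotient m` recovers i.
  oracle : ∀ {n} m → BitString n → Matrix (suc n ℕ.* m) (suc n ℕ.* m)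
  oracle m x = diag (λ k → ∣F⟩ x (quotient m k))

  record OneQueryAlgorithm (n : ℕ) : Set where
    field
      workDim : ℕ

    dim : ℕ
    dim = suc n ℕ.* workDim

    field
      initial       : Vector ℂ dim
      initial-unit  : ‖ initial ‖² ℝ.≈ ℝ.1#
      U₀ U₁         : Matrix dim dim
      U₀-unitary    : IsUnitary U₀
      U₁-unitary    : IsUnitary U₁
      P             : Bool → Matrix dim dim
      P-measurement : IsProjectiveMeasurement P

    final : BitString n → Vector ℂ dim
    final x = U₁ · oracle workDim x · U₀ · initial

    probability : BitString n → Bool → ℝ.Carrier
    probability x b = ‖ P b · final x ‖²

  module _ {n} (f : PartialBooleanFunction n) where
    open PartialBooleanFunction f

    ComputesExactly : OneQueryAlgorithm n → Set
    ComputesExactly 𝒜 =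
      ∀ x (x∈D : x ∈ domain) → probability x (value x x∈D) ℝ.≈ ℝ.1#
      where open OneQueryAlgorithm 𝒜

    -- On the domain, the last q rows then sum to 1 - f(x), the value of the
    -- negation of f.
    record IsSOSRepresentation p q (A : Matrix (p ℕ.+ q) (suc n)) : Set where
      field
        represents : ∀ x (x∈D : x ∈ domain) →
          ∑ℝ (λ (l : Fin p) → ∣ (A · ∣F⟩ x) (l ↑ˡ q) ∣²)
            ℝ.≈ (if value x x∈D then ℝ.1# else ℝ.0#)
        normalised : ∀ x →
          ∑ℝ (λ (l : Fin (p ℕ.+ q)) → ∣ (A · ∣F⟩ x) l ∣²) ℝ.≈ ℝ.1#

-- (⇒) Split the state φ = U₀ψ into its components φ_i on the blocks |i,·⟩. The oracle
-- multiplies φ_i by the i-th entry of F(x), so the final state is B F(x), where B has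
-- the columns U₁φ_i, which are pairwise orthogonal because the blocks are. Stacking
-- P_true B on P_false B keeps the inner products of the columns, because
-- P_true + P_false = 1.
--
-- (⇐) Let a_0, …, a_n be the columns of A. The initial state has a_i in block i; its
-- norm is 1 because the final state has norm ‖A F(x)‖. Take U₀ = 1. As the a_i are
-- orthogonal, so are the vectors w_i = (a_i in block 0) - (a_i in block i) for i ≥ 1, and
-- the product U₁ of the reflections in the w_i ≠ 0 moves every a_i to block 0. The final
-- state is then A F(x) in block 0, and measuring whether the row is among the first p
-- gives f(x). Using a_i itself rather than its normalisation avoids square roots.

module Submission where

open import Defs
open import Algebra.Bundles using (CommutativeMonoid; CommutativeRing; RawRing)
import Algebra.Consequences.Setoid as Consequences
import Algebra.Definitions
open import Algebra.Morphism.Structures using (module RingMorphisms)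
import Algebra.Properties.CommutativeMonoid.Sum as MonoidSum
import Algebra.Properties.Ring as RingProperties
import Algebra.Properties.Semiring.Mult as Mult
import Algebra.Properties.Semiring.Sum as SemiringSum
import Algebra.Solver.Ring
open import Algebra.Solver.Ring.AlmostCommutativeRing
  using (fromCommutativeRing; _-Raw-AlmostCommutative⟶_)
import Algebra.Solver.Ring.NaturalCoefficients.Default as SemiringSolver
open import Data.Bool using (Bool; true; false; if_then_else_)
open import Data.Fin using (Fin; zero; suc; _↑ˡ_; _↑ʳ_; splitAt; combine; quotient; remainder)
open import Data.Fin.Properties using (_≟_; splitAt-↑ˡ; splitAt-↑ʳ; remQuot-combine)
open import Data.Maybe using (Maybe; just; nothing)
open import Data.Nat using (ℕ; suc)
import Data.Nat as ℕ
open import Data.Product using (∃-syntax; Σ-syntax; _×_; _,_; proj₁; proj₂)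
open import Data.Sum using (inj₁; inj₂; [_,_])
open import Data.Vec using (lookup; replicate)
open import Data.Vec.Functional using (Vector; _++_)
open import Data.Vec.Functional.Properties using (lookup-++ˡ; lookup-++ʳ)
open import Function.Bundles using (_⇔_; mk⇔)
open import Level using (0ℓ)
open import Relation.Binary.Bundles using (Setoid)
open import Relation.Binary.PropositionalEquality as ≡ using (_≡_; _≢_)
import Relation.Binary.Reasoning.Setoid as SetoidReasoning
open import Relation.Binary.Structures using (IsDecTotalOrder; IsEquivalence)
open import Relation.Nullary using (yes; no; does; contradiction)
open import Relation.Unary using (_∈_)

-- Integer coefficients as formal differences; the library's solver
-- instances for a ring without computable equality have no cancellation.
module RingSolver (R : CommutativeRing 0ℓ 0ℓ) where
  open CommutativeRing R
  open RingProperties ring using (-1*x≈-x; -‿involutive)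
  open Mult semiring using (×-homo-+; ×1-homo-*) renaming (_×_ to _×′_)
  open SetoidReasoning setoid
  private
    module S = SemiringSolver commutativeSemiring

    differences : RawRing 0ℓ 0ℓ
    differences = record
      { Carrier = ℕ × ℕ
      ; _≈_     = _≡_
      ; _+_     = λ (a , b) (c , d) → a ℕ.+ c , b ℕ.+ d
      ; _*_     = λ (a , b) (c , d) → a ℕ.* c ℕ.+ b ℕ.* d , a ℕ.* d ℕ.+ b ℕ.* c
      ; -_      = λ (a , b) → b , a
      ; 0#      = 0 , 0
      ; 1#      = 1 , 0
      }

    ι : ℕ → Carrier
    ι a = a ×′ 1#

    -- The pair (a, b) stands for a - b. The difference is written with a factor `- 1#` so that the
    -- semiring solver, which knows no negation, can treat `- 1#` as one more variable m.
    ⟦_⟧ : ℕ × ℕ → Carrier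
    ⟦ a , b ⟧ = ι a + ι b * - 1#

    -1*-1≈1 : - 1# * - 1# ≈ 1#
    -1*-1≈1 = trans (-1*x≈-x (- 1#)) (-‿involutive 1#)

    morphism : differences -Raw-AlmostCommutative⟶ fromCommutativeRing R
    morphism = record
      { ⟦_⟧    = ⟦_⟧
      ; +-homo = λ (a , b) (c , d) → begin
          ι (a ℕ.+ c) + ι (b ℕ.+ d) * - 1#
            ≈⟨ +-cong (×-homo-+ 1# a c) (*-congʳ (×-homo-+ 1# b d)) ⟩
          (ι a + ι c) + (ι b + ι d) * - 1#
            ≈⟨ S.solve 5 (λ a b c d m → (a S.:+ c) S.:+ (b S.:+ d) S.:* m
                 S.:= (a S.:+ b S.:* m) S.:+ (c S.:+ d S.:* m)) refl (ι a) (ι b) (ι c) (ι d) (- 1#) ⟩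
          ⟦ a , b ⟧ + ⟦ c , d ⟧ ∎
      ; *-homo = λ (a , b) (c , d) → begin
          ι (a ℕ.* c ℕ.+ b ℕ.* d) + ι (a ℕ.* d ℕ.+ b ℕ.* c) * - 1#
            ≈⟨ +-cong (products a c b d) (*-congʳ (products a d b c)) ⟩
          (ι a * ι c + ι b * ι d) + (ι a * ι d + ι b * ι c) * - 1#
            -- Inserts (-1)² = 1: as polynomials in m the two sides agree only once bd is replaced
            -- by bd m².
            ≈⟨ +-congʳ (+-congˡ (trans (*-congˡ -1*-1≈1) (*-identityʳ _))) ⟨
          (ι a * ι c + (ι b * ι d) * (- 1# * - 1#)) + (ι a * ι d + ι b * ι c) * - 1#
            ≈⟨ S.solve 5 (λ a b c d m →
                 (a S.:* c S.:+ (b S.:* d) S.:* (m S.:* m)) S.:+ (a S.:* d S.:+ b S.:* c) S.:* m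
                 S.:= (a S.:+ b S.:* m) S.:* (c S.:+ d S.:* m)) refl (ι a) (ι b) (ι c) (ι d) (- 1#) ⟩
          ⟦ a , b ⟧ * ⟦ c , d ⟧ ∎
      ; -‿homo = λ (a , b) → begin
          ι b + ι a * - 1#
            ≈⟨ +-congʳ (trans (*-congˡ -1*-1≈1) (*-identityʳ _)) ⟨
          ι b * (- 1# * - 1#) + ι a * - 1#
            ≈⟨ S.solve 3 (λ a b m → b S.:* (m S.:* m) S.:+ a S.:* m
                 S.:= m S.:* (a S.:+ b S.:* m)) refl (ι a) (ι b) (- 1#) ⟩
          - 1# * ⟦ a , b ⟧  ≈⟨ -1*x≈-x _ ⟩
          - ⟦ a , b ⟧ ∎
      ; 0-homo = trans (+-identityˡ _) (zeroˡ _)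
      ; 1-homo = trans (+-cong (+-identityʳ _) (zeroˡ _)) (+-identityʳ _)
      }
      where
      products : ∀ a c b d → ι (a ℕ.* c ℕ.+ b ℕ.* d) ≈ ι a * ι c + ι b * ι d
      products a c b d = trans (×-homo-+ 1# (a ℕ.* c) (b ℕ.* d)) (+-cong (×1-homo-* a c) (×1-homo-* b d))

    -- Recognising zero suffices for cancellation.
    _coeff≟_ : ∀ x y → Maybe (⟦ x ⟧ ≈ ⟦ y ⟧)
    (a , b) coeff≟ (c , d) with a ℕ.≟ b | c ℕ.≟ d
    ... | yes ≡.refl | yes ≡.refl = just (trans (null a) (sym (null c)))
      where
      null : ∀ a → ⟦ a , a ⟧ ≈ 0#
      null a = trans (+-congˡ (trans (*-comm _ _) (-1*x≈-x _))) (-‿inverseʳ _)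
    ... | _ | _ = nothing

  open Algebra.Solver.Ring differences (fromCommutativeRing R) morphism _coeff≟_ public
    using (solve; _:=_; _:+_; _:*_; :-_; _:-_)

-- Finite sums over concatenated and product index sets.

module Sums (M : CommutativeMonoid 0ℓ 0ℓ) where
  open CommutativeMonoid M
  open MonoidSum M

  sum-0 : ∀ {n} {f : Vector Carrier n} → (∀ i → f i ≈ ε) → sum f ≈ ε
  sum-0 {n} f≈0 = trans (sum-cong-≋ f≈0) (sum-replicate-zero n)

  sum-++ : ∀ m {n} (f : Vector Carrier (m ℕ.+ n)) →
           sum f ≈ sum (λ i → f (i ↑ˡ n)) ∙ sum (λ j → f (m ↑ʳ j))
  sum-++ ℕ.zero  f = sym (identityˡ _)
  sum-++ (suc m) f = trans (∙-congˡ (sum-++ m _)) (sym (assoc _ _ _))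

  sum-combine : ∀ m {n} (f : Vector Carrier (m ℕ.* n)) →
                sum f ≈ sum (λ (i : Fin m) → sum (λ (j : Fin n) → f (combine i j)))
  sum-combine ℕ.zero      f = refl
  sum-combine (suc m) {n} f = trans (sum-++ n f) (∙-congˡ (sum-combine m _))

  -- |i,j⟩ has index `combine i j`, as in the definition of the oracle.
  flatten : ∀ {m n} → (Fin m → Fin n → Carrier) → Vector Carrier (m ℕ.* n)
  flatten {m} {n} g k = g (quotient n k) (remainder {m} n k)

  sum-flatten : ∀ {m n} (g : Fin m → Fin n → Carrier) →
                sum (flatten g) ≈ sum (λ i → sum (g i))
  sum-flatten {m} g = trans (sum-combine m (flatten g)) (sum-cong-≋ λ i → sum-cong-≋ λ j →
    reflexive (≡.cong (λ (q , r) → g q r) (remQuot-combine i j)))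

-- Linear algebra over a commutative ring with an involution.

record Conjugation (R : CommutativeRing 0ℓ 0ℓ) : Set where
  open CommutativeRing R
  open RingMorphisms rawRing rawRing
  field
    conj               : Carrier → Carrier
    isRingHomomorphism : IsRingHomomorphism conj
    conj-involutive    : ∀ z → conj (conj z) ≈ z
  open IsRingHomomorphism isRingHomomorphism public
    using ()
    renaming ( ⟦⟧-cong to conj-cong; +-homo to conj-+; *-homo to conj-*
             ; 0#-homo to conj-0#; 1#-homo to conj-1#; -‿homo to conj-‿- )

-- The matrix operations of `Over` are repeated for an abstract ring, where arithmetic does not
-- unfold into real and imaginary parts. At ℂ they agree definitionally with the originals, so the
-- lemmas apply there as they stand.
module LinearAlgebra (R : CommutativeRing 0ℓ 0ℓ) (C : Conjugation R) where
  open CommutativeRing R hiding (zero)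
  open RingProperties ring using (-0#≈0#; -‿involutive; -‿distribˡ-*; -‿distribʳ-*; -‿+-comm)
  open Conjugation C
  open SemiringSum semiring
  open Sums +-commutativeMonoid
  open RingSolver R
  open SetoidReasoning setoid

  Matrix : ℕ → ℕ → Set
  Matrix m n = Fin m → Fin n → Carrier

  infix 4 _≋_
  _≋_ : ∀ {m n} → Matrix m n → Matrix m n → Set
  A ≋ B = ∀ i j → A i j ≈ B i j

  infixl 7 _⊡_
  _⊡_ : ∀ {m n k} → Matrix m n → Matrix n k → Matrix m k
  (A ⊡ B) i k = sum (λ j → A i j * B j k)

  infixr 7 _·_
  _·_ : ∀ {m n} → Matrix m n → Vector Carrier n → Vector Carrier m
  (A · v) i = sum (λ j → A i j * v j)

  infixl 8 _†
  _† : ∀ {m n} → Matrix m n → Matrix n m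
  (A †) i j = conj (A j i)

  diag : ∀ {n} → Vector Carrier n → Matrix n n
  diag u i j = if does (i ≟ j) then u i else 0#

  𝟙 : ∀ {n} → Matrix n n
  𝟙 = diag (λ _ → 1#)

  column : ∀ {m n} → Matrix m n → Fin n → Vector Carrier m
  column A j i = A i j

  ⟨_,_⟩ : ∀ {n} → Vector Carrier n → Vector Carrier n → Carrier
  ⟨ v , w ⟩ = sum (λ i → conj (v i) * w i)

  sum-neg : ∀ {n} (f : Vector Carrier n) → sum (λ i → - f i) ≈ - sum f
  sum-neg {ℕ.zero} f = sym -0#≈0#
  sum-neg {suc n}  f = trans (+-congˡ (sum-neg λ i → f (suc i))) (-‿+-comm _ _)

  conj-sum : ∀ {n} (f : Vector Carrier n) → conj (sum f) ≈ sum (λ i → conj (f i))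
  conj-sum {ℕ.zero} f = conj-0#
  conj-sum {suc n}  f = trans (conj-+ _ _) (+-congˡ (conj-sum λ i → f (suc i)))

  conj-neg-* : ∀ z w → conj (- z) * - w ≈ conj z * w
  conj-neg-* z w = trans (*-congʳ (conj-‿- z))
    (solve 2 (λ z w → :- z :* :- w := z :* w) refl (conj z) w)

  ·-congˡ : ∀ {m n} (A : Matrix m n) {v w} → (∀ j → v j ≈ w j) → ∀ i → (A · v) i ≈ (A · w) i
  ·-congˡ A v≈w i = sum-cong-≋ λ j → *-congˡ (v≈w j)

  ·-congʳ : ∀ {m n} {A B : Matrix m n} {v} → A ≋ B → ∀ i → (A · v) i ≈ (B · v) i
  ·-congʳ A≋B i = sum-cong-≋ λ j → *-congʳ (A≋B i j)

  ·-assoc : ∀ {m n k} (A : Matrix m n) (B : Matrix n k) v i → ((A ⊡ B) · v) i ≈ (A · B · v) i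
  ·-assoc A B v i = begin
    sum (λ k → sum (λ j → A i j * B j k) * v k)
      ≈⟨ sum-cong-≋ (λ k → *-distribʳ-sum (v k) (λ j → A i j * B j k)) ⟩
    sum (λ k → sum (λ j → A i j * B j k * v k))
      ≈⟨ ∑-comm (λ k j → A i j * B j k * v k) ⟩
    sum (λ j → sum (λ k → A i j * B j k * v k))
      ≈⟨ sum-cong-≋ (λ j → sum-cong-≋ (λ k → *-assoc (A i j) (B j k) (v k))) ⟩
    sum (λ j → sum (λ k → A i j * (B j k * v k)))
      ≈⟨ sum-cong-≋ (λ j → *-distribˡ-sum (A i j) (λ k → B j k * v k)) ⟨
    sum (λ j → A i j * sum (λ k → B j k * v k)) ∎

  -- Recursion works because `does (suc i ≟ suc j)` computes to `does (i ≟ j)`: a diagonal matrix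
  -- without its first row and column is again a `diag`.
  diag-· : ∀ {n} (u v : Vector Carrier n) i → (diag u · v) i ≈ u i * v i
  diag-· u v zero    = trans (+-congˡ (sum-0 λ j → zeroˡ (v (suc j)))) (+-identityʳ _)
  diag-· u v (suc i) =
    trans (+-cong (zeroˡ _) (diag-· (λ j → u (suc j)) (λ j → v (suc j)) i)) (+-identityˡ _)

  𝟙-· : ∀ {n} (v : Vector Carrier n) i → (𝟙 · v) i ≈ v i
  𝟙-· v i = trans (diag-· _ v i) (*-identityˡ _)

  diag-sym : ∀ {n} (u : Vector Carrier n) i j → diag u i j ≡ diag u j i
  diag-sym u zero    zero    = ≡.refl
  diag-sym u zero    (suc j) = ≡.refl
  diag-sym u (suc i) zero    = ≡.refl
  diag-sym u (suc i) (suc j) = diag-sym (λ k → u (suc k)) i j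

  diag-diag : ∀ {n} (u : Vector Carrier n) i → diag u i i ≡ u i
  diag-diag u zero    = ≡.refl
  diag-diag u (suc i) = diag-diag (λ k → u (suc k)) i

  diag-† : ∀ {n} (u : Vector Carrier n) → diag u † ≋ diag (λ i → conj (u i))
  diag-† u i j rewrite diag-sym u j i with does (i ≟ j)
  ... | true  = refl
  ... | false = conj-0#

  diag-cong : ∀ {n} {u v : Vector Carrier n} → (∀ i → u i ≈ v i) → diag u ≋ diag v
  diag-cong u≈v i j with does (i ≟ j)
  ... | true  = u≈v i
  ... | false = refl

  diag-⊡ : ∀ {n} (u v : Vector Carrier n) → diag u ⊡ diag v ≋ diag (λ i → u i * v i)
  diag-⊡ u v i k = trans (diag-· u (column (diag v) k) i) lemma
    where
    lemma : u i * diag v i k ≈ diag (λ i → u i * v i) i k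
    lemma with does (i ≟ k)
    ... | true  = refl
    ... | false = zeroʳ _

  -- Inner products, isometries and projections.

  ⟨⟩-cong : ∀ {n} {v v′ w w′ : Vector Carrier n} →
            (∀ i → v i ≈ v′ i) → (∀ i → w i ≈ w′ i) → ⟨ v , w ⟩ ≈ ⟨ v′ , w′ ⟩
  ⟨⟩-cong v≈v′ w≈w′ = sum-cong-≋ λ i → *-cong (conj-cong (v≈v′ i)) (w≈w′ i)

  adjoint : ∀ {m n} (A : Matrix m n) v w → ⟨ A · v , w ⟩ ≈ ⟨ v , A † · w ⟩
  adjoint A v w = begin
    sum (λ i → conj (sum (λ j → A i j * v j)) * w i)
      ≈⟨ sum-cong-≋ (λ i → trans (*-congʳ (conj-sum (λ j → A i j * v j)))
                                 (*-distribʳ-sum (w i) (λ j → conj (A i j * v j)))) ⟩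
    sum (λ i → sum (λ j → conj (A i j * v j) * w i))
      ≈⟨ ∑-comm (λ i j → conj (A i j * v j) * w i) ⟩
    sum (λ j → sum (λ i → conj (A i j * v j) * w i))
      ≈⟨ sum-cong-≋ (λ j → sum-cong-≋ (λ i → trans (*-congʳ (conj-* (A i j) (v j)))
           (solve 3 (λ a v w → a :* v :* w := v :* (a :* w)) refl (conj (A i j)) (conj (v j)) (w i)))) ⟩
    sum (λ j → sum (λ i → conj (v j) * (conj (A i j) * w i)))
      ≈⟨ sum-cong-≋ (λ j → *-distribˡ-sum (conj (v j)) (λ i → conj (A i j) * w i)) ⟨
    sum (λ j → conj (v j) * sum (λ i → conj (A i j) * w i)) ∎

  -- Moving A to the other side as A† shows that inner products of images depend on A only through
  -- its Gram matrix. Isometries are the case M = 1, and orthogonal projections the case M = A.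
  gram-· : ∀ {m n} {A : Matrix m n} {M} → A † ⊡ A ≋ M → ∀ v w → ⟨ A · v , A · w ⟩ ≈ ⟨ v , M · w ⟩
  gram-· {A = A} {M} A†A≋M v w = begin
    ⟨ A · v , A · w ⟩      ≈⟨ adjoint A v (A · w) ⟩
    ⟨ v , A † · A · w ⟩    ≈⟨ ⟨⟩-cong (λ _ → refl) (λ i → trans (sym (·-assoc (A †) A w i)) (·-congʳ A†A≋M i)) ⟩
    ⟨ v , M · w ⟩          ∎

  isometry : ∀ {m n} {U : Matrix m n} → U † ⊡ U ≋ 𝟙 → ∀ v w → ⟨ U · v , U · w ⟩ ≈ ⟨ v , w ⟩
  isometry {U = U} U†U≋𝟙 v w =
    trans (gram-· {A = U} U†U≋𝟙 v w) (⟨⟩-cong (λ _ → refl) (𝟙-· w))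

  gram-diagonal : ∀ {m n} (A : Matrix m n) → (∀ {i j} → i ≢ j → ⟨ column A i , column A j ⟩ ≈ 0#) →
                  A † ⊡ A ≋ diag (λ i → ⟨ column A i , column A i ⟩)
  gram-diagonal A orthogonal i j with i ≟ j
  ... | yes ≡.refl = refl
  ... | no  i≢j    = orthogonal i≢j

  -- For a projection P†P = P, so each term on the left is ⟨v, Pw⟩ or ⟨v, P′w⟩, and these add up by
  -- completeness. With v = w this is conservation of probability; with two columns of a matrix it
  -- shows that stacking the projected parts preserves orthogonality.
  measurement : ∀ {n} {P P′ : Matrix n n} →
                P † ≋ P → P ⊡ P ≋ P → P′ † ≋ P′ → P′ ⊡ P′ ≋ P′ →
                (∀ i j → P i j + P′ i j ≈ 𝟙 i j) →
                ∀ v w → ⟨ P · v , P · w ⟩ + ⟨ P′ · v , P′ · w ⟩ ≈ ⟨ v , w ⟩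
  measurement {n} {P} {P′} P†≋P PP≋P P′†≋P′ P′P′≋P′ P+P′≋𝟙 v w = begin
    ⟨ P · v , P · w ⟩ + ⟨ P′ · v , P′ · w ⟩
      ≈⟨ +-cong (project P P†≋P PP≋P) (project P′ P′†≋P′ P′P′≋P′) ⟩
    ⟨ v , P · w ⟩ + ⟨ v , P′ · w ⟩
      ≈⟨ ∑-distrib-+ (λ i → conj (v i) * (P · w) i) (λ i → conj (v i) * (P′ · w) i) ⟨
    sum (λ i → conj (v i) * (P · w) i + conj (v i) * (P′ · w) i)
      ≈⟨ sum-cong-≋ (λ i → trans (sym (distribˡ _ _ _)) (*-congˡ (resolve i))) ⟩
    ⟨ v , w ⟩ ∎
    where
    project : ∀ (P : Matrix n n) → P † ≋ P → P ⊡ P ≋ P → ⟨ P · v , P · w ⟩ ≈ ⟨ v , P · w ⟩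
    project P P†≋P PP≋P =
      gram-· {A = P} (λ i j → trans (sum-cong-≋ λ k → *-congʳ (P†≋P i k)) (PP≋P i j)) v w

    resolve : ∀ i → (P · w) i + (P′ · w) i ≈ w i
    resolve i = begin
      (P · w) i + (P′ · w) i
        ≈⟨ ∑-distrib-+ (λ j → P i j * w j) (λ j → P′ i j * w j) ⟨
      sum (λ j → P i j * w j + P′ i j * w j)
        ≈⟨ sum-cong-≋ (λ j → trans (sym (distribʳ _ _ _)) (*-congʳ (P+P′≋𝟙 i j))) ⟩
      (𝟙 · w) i ≈⟨ 𝟙-· w i ⟩
      w i ∎

  ⟨⟩-++ : ∀ {m m′ n} (A : Matrix m n) (B : Matrix m′ n) i j →
          ⟨ column (A ++ B) i , column (A ++ B) j ⟩
            ≈ ⟨ column A i , column A j ⟩ + ⟨ column B i , column B j ⟩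
  ⟨⟩-++ {m} {m′} A B i j = trans
    (sum-++ m λ k → conj ((A ++ B) k i) * (A ++ B) k j)
    (+-cong (sum-cong-≋ λ k → reflexive (≡.cong (λ a → conj (a i) * a j) (lookup-++ˡ A B k)))
            (sum-cong-≋ λ k → reflexive (≡.cong (λ b → conj (b i) * b j) (lookup-++ʳ A B k))))

  -- Column i is the part of φ in the block |i,·⟩. Row k is a row of a constant diagonal matrix,
  -- which puts φ k in the column of its block and 0 elsewhere.
  spread : ∀ {n m} → Vector Carrier (n ℕ.* m) → Matrix (n ℕ.* m) n
  spread {m = m} φ k = diag (λ _ → φ k) (quotient m k)

  spread-· : ∀ {n m} (φ : Vector Carrier (n ℕ.* m)) F k →
             (spread {n} {m} φ · F) k ≈ φ k * F (quotient m k)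
  spread-· {m = m} φ F k = diag-· (λ _ → φ k) F (quotient m k)

  -- Distinct columns have disjoint supports, as every index k lies in a single block.
  spread-orthogonal : ∀ {n m} (φ : Vector Carrier (n ℕ.* m)) {i j} → i ≢ j →
                      ⟨ column (spread {n} {m} φ) i , column (spread {n} {m} φ) j ⟩ ≈ 0#
  spread-orthogonal {n} {m} φ {i} {j} i≢j = sum-0 λ k → disjoint (φ k) (quotient m k)
    where
    disjoint : ∀ z (q : Fin n) → conj (diag (λ _ → z) q i) * diag (λ _ → z) q j ≈ 0#
    disjoint z q with q ≟ i | q ≟ j
    ... | yes ≡.refl | yes ≡.refl = contradiction ≡.refl i≢j
    ... | yes _      | no _       = zeroʳ _
    ... | no _       | _          = trans (*-congʳ conj-0#) (zeroˡ _)

  -- The product of the Householder reflections 1 - 2ww†/‖w‖² in the columns w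
  -- of W, where ‖w‖² = 2s; c inverts s except at zero columns, where it is junk.
  module Reflection {d n} (W : Matrix d n) (c s : Vector Carrier n)
                    (conj-c : ∀ i → conj (c i) ≈ c i)
                    (gram   : W † ⊡ W ≋ diag (λ i → s i + s i))
                    (scale  : ∀ k i → W k i * (c i * s i) ≈ W k i) where
    private
      Y : Matrix n d
      Y i k = c i * conj (W k i)

      -- The sum of c_i w_i w_i† over the columns. Over ℂ this is twice the orthogonal projection
      -- onto their span, since c_i = 2/‖w_i‖² wherever w_i is not zero.
      Q : Matrix d d
      Q = W ⊡ Y

    -- The w_i are pairwise orthogonal, so in the expanded product of the reflections all mixed
    -- terms vanish and 1 - Q remains.
    H : Matrix d d
    H k j = 𝟙 k j - Q k j

    private
      Q-· : ∀ v k → (Q · v) k ≈ (W · (λ i → c i * ⟨ column W i , v ⟩)) k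
      Q-· v k = trans (·-assoc W Y v k) (·-congˡ W (λ i → trans
        (sum-cong-≋ λ j → *-assoc (c i) (conj (W j i)) (v j))
        (sym (*-distribˡ-sum (c i) (λ j → conj (W j i) * v j)))) k)

      Q-† : Q † ≋ Q
      Q-† k j = trans (conj-sum (λ i → W j i * Y i k)) (sum-cong-≋ λ i → begin
        conj (W j i * (c i * conj (W k i)))
          ≈⟨ trans (conj-* _ _) (*-congˡ (conj-* _ _)) ⟩
        conj (W j i) * (conj (c i) * conj (conj (W k i)))
          ≈⟨ *-congˡ (*-cong (conj-c i) (conj-involutive _)) ⟩
        conj (W j i) * (c i * W k i)
          ≈⟨ solve 3 (λ a b c → a :* (b :* c) := c :* (b :* a)) refl (conj (W j i)) (c i) (W k i) ⟩
        W k i * (c i * conj (W j i)) ∎)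

      -- This makes 1 - Q an involution, since (1 - Q)² = 1 - 2Q + Q².
      Q⊡Q : ∀ k j → (Q ⊡ Q) k j ≈ Q k j + Q k j
      Q⊡Q k j = begin
        (Q · column Q j) k
          ≈⟨ Q-· (column Q j) k ⟩
        (W · (λ i → c i * ⟨ column W i , W · column Y j ⟩)) k
          ≈⟨ sum-cong-≋ (λ i → *-congˡ (*-congˡ (inner i))) ⟩
        sum (λ i → W k i * (c i * ((s i + s i) * Y i j)))
          -- Brings `c i * s i` next to an entry of W, where `scale` removes it. At a zero column
          -- the product itself need not be 1.
          ≈⟨ sum-cong-≋ (λ i → solve 4 (λ w c s y → w :* (c :* ((s :+ s) :* y))
               := w :* (c :* s) :* y :+ w :* (c :* s) :* y) refl (W k i) (c i) (s i) (Y i j)) ⟩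
        sum (λ i → W k i * (c i * s i) * Y i j + W k i * (c i * s i) * Y i j)
          ≈⟨ sum-cong-≋ (λ i → +-cong (*-congʳ (scale k i)) (*-congʳ (scale k i))) ⟩
        sum (λ i → W k i * Y i j + W k i * Y i j)
          ≈⟨ ∑-distrib-+ (λ i → W k i * Y i j) (λ i → W k i * Y i j) ⟩
        Q k j + Q k j ∎
        where
        inner : ∀ i → ⟨ column W i , W · column Y j ⟩ ≈ (s i + s i) * Y i j
        inner i = begin
          (W † · W · column Y j) i                  ≈⟨ ·-assoc (W †) W (column Y j) i ⟨
          ((W † ⊡ W) · column Y j) i                ≈⟨ ·-congʳ gram i ⟩
          (diag (λ i → s i + s i) · column Y j) i   ≈⟨ diag-· (λ i → s i + s i) (column Y j) i ⟩
          (s i + s i) * Y i j                       ∎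

      H-· : ∀ v k → (H · v) k ≈ v k - (Q · v) k
      H-· v k = begin
        sum (λ j → (𝟙 k j - Q k j) * v j)
          ≈⟨ sum-cong-≋ (λ j → trans (distribʳ (v j) (𝟙 k j) (- Q k j))
                                     (+-congˡ (sym (-‿distribˡ-* (Q k j) (v j))))) ⟩
        sum (λ j → 𝟙 k j * v j + - (Q k j * v j))
          ≈⟨ ∑-distrib-+ (λ j → 𝟙 k j * v j) (λ j → - (Q k j * v j)) ⟩
        (𝟙 · v) k + sum (λ j → - (Q k j * v j))
          ≈⟨ +-cong (𝟙-· v k) (sum-neg (λ j → Q k j * v j)) ⟩
        v k - (Q · v) k ∎

      Q⊡𝟙 : Q ⊡ 𝟙 ≋ Q
      Q⊡𝟙 k j = trans
        (sum-cong-≋ λ i → trans (*-comm _ _) (*-congʳ (reflexive (diag-sym _ i j))))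
        (𝟙-· (Q k) j)

      Q⊡H : ∀ k j → (Q ⊡ H) k j ≈ Q k j - (Q k j + Q k j)
      Q⊡H k j = begin
        sum (λ i → Q k i * (𝟙 i j - Q i j))
          ≈⟨ sum-cong-≋ (λ i → trans (distribˡ (Q k i) (𝟙 i j) (- Q i j))
                                     (+-congˡ (sym (-‿distribʳ-* (Q k i) (Q i j))))) ⟩
        sum (λ i → Q k i * 𝟙 i j + - (Q k i * Q i j))
          ≈⟨ ∑-distrib-+ (λ i → Q k i * 𝟙 i j) (λ i → - (Q k i * Q i j)) ⟩
        (Q ⊡ 𝟙) k j + sum (λ i → - (Q k i * Q i j))
          ≈⟨ +-cong (Q⊡𝟙 k j) (sum-neg (λ i → Q k i * Q i j)) ⟩
        Q k j - (Q ⊡ Q) k j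
          ≈⟨ +-congˡ (-‿cong (Q⊡Q k j)) ⟩
        Q k j - (Q k j + Q k j) ∎

    H-† : H † ≋ H
    H-† k j = begin
      conj (𝟙 j k - Q j k)        ≈⟨ trans (conj-+ _ _) (+-congˡ (conj-‿- _)) ⟩
      conj (𝟙 j k) - conj (Q j k) ≈⟨ +-cong (trans (diag-† _ k j) (diag-cong (λ _ → conj-1#) k j))
                                            (-‿cong (Q-† k j)) ⟩
      𝟙 k j - Q k j               ∎

    H⊡H : H ⊡ H ≋ 𝟙
    H⊡H k j = begin
      (H · column H j) k                          ≈⟨ H-· (column H j) k ⟩
      H k j - (Q ⊡ H) k j                         ≈⟨ +-congˡ (-‿cong (Q⊡H k j)) ⟩
      𝟙 k j - Q k j - (Q k j - (Q k j + Q k j))   ≈⟨ solve 2 (λ o q → o :- q :- (q :- (q :+ q)) := o)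
                                                       refl (𝟙 k j) (Q k j) ⟩
      𝟙 k j                                       ∎

    H†⊡H : H † ⊡ H ≋ 𝟙
    H†⊡H k j = trans (sum-cong-≋ λ i → *-congʳ (H-† k i)) (H⊡H k j)

    H⊡H† : H ⊡ H † ≋ 𝟙
    H⊡H† k j = trans (sum-cong-≋ λ i → *-congˡ {H k i} (H-† i j)) (H⊡H k j)

    -- Hv = v - Σ c_i ⟨w_i, v⟩ w_i. With the inner products given as multiples of s_i, the factor
    -- c_i s_i is absorbed by w_i, so the result is free of c even when some columns vanish.
    H-translates : ∀ v y → (∀ i → ⟨ column W i , v ⟩ ≈ - (s i * y i)) →
                   ∀ k → (H · v) k ≈ v k + (W · y) k
    H-translates v y ⟨w,v⟩ k = begin
      (H · v) k                                        ≈⟨ H-· v k ⟩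
      v k - (Q · v) k                                  ≈⟨ +-congˡ (-‿cong Qv) ⟩
      v k - - (W · y) k                                ≈⟨ +-congˡ (-‿involutive _) ⟩
      v k + (W · y) k                                  ∎
      where
      Qv : (Q · v) k ≈ - (W · y) k
      Qv = begin
        (Q · v) k                                           ≈⟨ Q-· v k ⟩
        sum (λ i → W k i * (c i * ⟨ column W i , v ⟩))      ≈⟨ sum-cong-≋ (λ i → *-congˡ (*-congˡ (⟨w,v⟩ i))) ⟩
        sum (λ i → W k i * (c i * - (s i * y i)))           ≈⟨ sum-cong-≋ (λ i → solve 4 (λ w c s y →
                                                                 w :* (c :* :- (s :* y)) := :- (w :* (c :* s) :* y))
                                                                 refl (W k i) (c i) (s i) (y i)) ⟩
        sum (λ i → - (W k i * (c i * s i) * y i))           ≈⟨ sum-cong-≋ (λ i → -‿cong (*-congʳ (scale k i))) ⟩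
        sum (λ i → - (W k i * y i))                         ≈⟨ sum-neg (λ i → W k i * y i) ⟩
        - (W · y) k                                         ∎

  -- `block q l i` is the entry at |q,l⟩ of (a_(i+1) in block 0) - (a_(i+1) in block i+1).
  -- There is no vector for a_0, which is in block 0 from the start.
  module Gather {r n} (A : Matrix r (suc n)) (u c : Vector Carrier (suc n))
                (conj-c : ∀ i → conj (c i) ≈ c i)
                (gram   : A † ⊡ A ≋ diag u)
                (scale  : ∀ l i → A l i * (c i * u i) ≈ A l i) where

    block : Fin (suc n) → Fin r → Fin n → Carrier
    block zero    l i = A l (suc i)
    block (suc j) l i = - diag (λ i → A l (suc i)) i j

    W : Matrix (suc n ℕ.* r) n
    W k i = flatten (λ q l → block q l i) k

    W-inner : ∀ i (x : Fin (suc n) → Fin r → Carrier) →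
      ⟨ column W i , flatten x ⟩ ≈ ⟨ column A (suc i) , x zero ⟩ - ⟨ column A (suc i) , x (suc i) ⟩
    W-inner i x = trans (sum-flatten (λ q l → conj (block q l i) * x q l)) (+-congˡ (begin
      sum (λ j → sum (λ l → conj (- diag (λ i → A l (suc i)) i j) * x (suc j) l))
        -- With l outermost, the sum over the blocks j is a row of a diagonal matrix applied to a
        -- vector, which selects j = i.
        ≈⟨ ∑-comm (λ j l → conj (- diag (λ i → A l (suc i)) i j) * x (suc j) l) ⟩
      sum (λ l → sum (λ j → conj (- diag (λ i → A l (suc i)) i j) * x (suc j) l))
        ≈⟨ sum-cong-≋ (λ l → sum-cong-≋ (λ j → trans (*-congʳ (conj-block l j)) (sym (-‿distribˡ-* _ _)))) ⟩
      sum (λ l → sum (λ j → - (diag (λ i → conj (A l (suc i))) i j * x (suc j) l)))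
        ≈⟨ sum-cong-≋ (λ l → trans
             (sum-neg (λ j → diag (λ i → conj (A l (suc i))) i j * x (suc j) l))
             (-‿cong (diag-· (λ i → conj (A l (suc i))) (λ j → x (suc j) l) i))) ⟩
      sum (λ l → - (conj (A l (suc i)) * x (suc i) l))
        ≈⟨ sum-neg (λ l → conj (A l (suc i)) * x (suc i) l) ⟩
      - ⟨ column A (suc i) , x (suc i) ⟩ ∎))
      where
      conj-block : ∀ l j → conj (- diag (λ i → A l (suc i)) i j) ≈ - diag (λ i → conj (A l (suc i))) i j
      conj-block l j = trans (conj-‿- _) (-‿cong (trans
        (diag-† _ j i) (reflexive (diag-sym (λ i → conj (A l (suc i))) j i))))

    -- Block 0 contributes ⟨a_(i+1), a_(j+1)⟩. The lower blocks contribute the same on the diagonal,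
    -- their two signs cancelling, and nothing off it. Hence ‖w_i‖² = 2s with s = u_(i+1), and c =
    -- 1/u_(i+1) is the right coefficient.
    W-gram : W † ⊡ W ≋ diag (λ i → u (suc i) + u (suc i))
    W-gram i j = begin
      ⟨ column W i , column W j ⟩
        ≈⟨ W-inner i (λ q l → block q l j) ⟩
      ⟨ column A (suc i) , column A (suc j) ⟩ - ⟨ column A (suc i) , (λ l → block (suc i) l j) ⟩
        ≈⟨ +-cong (gram (suc i) (suc j)) (-‿cong lower) ⟩
      diag (λ i → u (suc i)) i j - - diag (λ i → u (suc i)) i j
        ≈⟨ +-congˡ (-‿involutive _) ⟩
      diag (λ i → u (suc i)) i j + diag (λ i → u (suc i)) i j
        ≈⟨ double ⟩
      diag (λ i → u (suc i) + u (suc i)) i j ∎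
      where
      double : diag (λ i → u (suc i)) i j + diag (λ i → u (suc i)) i j ≈ diag (λ i → u (suc i) + u (suc i)) i j
      double with does (i ≟ j)
      ... | true  = refl
      ... | false = +-identityˡ _

      lower : ⟨ column A (suc i) , (λ l → block (suc i) l j) ⟩ ≈ - diag (λ i → u (suc i)) i j
      lower = begin
        sum (λ l → conj (A l (suc i)) * - diag (λ i → A l (suc i)) j i)
          ≈⟨ sum-cong-≋ (λ l → sym (-‿distribʳ-* (conj (A l (suc i))) (diag (λ i → A l (suc i)) j i))) ⟩
        sum (λ l → - (conj (A l (suc i)) * diag (λ i → A l (suc i)) j i))
          ≈⟨ sum-neg (λ l → conj (A l (suc i)) * diag (λ i → A l (suc i)) j i) ⟩
        - sum (λ l → conj (A l (suc i)) * diag (λ i → A l (suc i)) j i)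
          ≈⟨ -‿cong (trans (sum-cong-≋ λ l → *-congˡ {conj (A l (suc i))} (reflexive (diag-sym (λ i → A l (suc i)) j i))) off) ⟩
        - diag (λ i → u (suc i)) i j ∎
        where
        off : sum (λ l → conj (A l (suc i)) * diag (λ i → A l (suc i)) i j) ≈ diag (λ i → u (suc i)) i j
        off with i ≟ j
        ... | yes ≡.refl = trans (gram (suc i) (suc i)) (reflexive (diag-diag u (suc i)))
        ... | no _       = sum-0 λ l → zeroʳ (conj (A l (suc i)))

    -- Up to sign, every entry in column i of W is 0 or an entry of a_(i+1), so `scale` carries
    -- over.
    W-scale : ∀ k i → W k i * (c (suc i) * u (suc i)) ≈ W k i
    W-scale k i = block-scale (quotient r k) (remainder {suc n} r k)
      where
      block-scale : ∀ q l → block q l i * (c (suc i) * u (suc i)) ≈ block q l i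
      block-scale zero    l = scale l (suc i)
      block-scale (suc j) l = trans (sym (-‿distribˡ-* _ _)) (-‿cong diagonal)
        where
        diagonal : diag (λ i → A l (suc i)) i j * (c (suc i) * u (suc i)) ≈ diag (λ i → A l (suc i)) i j
        diagonal with does (i ≟ j)
        ... | true  = scale l (suc i)
        ... | false = zeroˡ _

    open Reflection W (λ i → c (suc i)) (λ i → u (suc i)) (λ i → conj-c (suc i)) W-gram W-scale public
      using (H; H†⊡H; H⊡H†; H-translates)

    gathered : Vector Carrier (suc n) → Fin (suc n) → Fin r → Carrier
    gathered F zero    = A · F
    gathered F (suc _) = λ _ → 0#

    -- The inner products with the w_i are -u_(i+1) F_(i+1), so H adds Σ F_(i+1) w_i. This takes
    -- F_(i+1) a_(i+1) out of block i+1 and puts it into block 0, for all phases F at once.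
    H-gathers : ∀ F k → (H · flatten (λ q l → F q * A l q)) k ≈ flatten (gathered F) k
    H-gathers F k = trans
      (H-translates (flatten x) (λ i → F (suc i)) inner k)
      (translated (quotient r k) (remainder {suc n} r k))
      where
      x : Fin (suc n) → Fin r → Carrier
      x q l = F q * A l q

      pull : ∀ i j → ⟨ column A i , x j ⟩ ≈ F j * diag u i j
      pull i j = begin
        sum (λ l → conj (A l i) * (F j * A l j))
          ≈⟨ sum-cong-≋ (λ l → solve 3 (λ a f b → a :* (f :* b) := f :* (a :* b))
                                 refl (conj (A l i)) (F j) (A l j)) ⟩
        sum (λ l → F j * (conj (A l i) * A l j))
          ≈⟨ *-distribˡ-sum (F j) (λ l → conj (A l i) * A l j) ⟨
        F j * (A † ⊡ A) i j
          ≈⟨ *-congˡ (gram i j) ⟩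
        F j * diag u i j ∎

      inner : ∀ i → ⟨ column W i , flatten x ⟩ ≈ - (u (suc i) * F (suc i))
      inner i = begin
        ⟨ column W i , flatten x ⟩
          ≈⟨ W-inner i x ⟩
        ⟨ column A (suc i) , x zero ⟩ - ⟨ column A (suc i) , x (suc i) ⟩
          -- `diag u (suc i) zero` computes to `0#`: the content of block 0 is a multiple of a_0,
          -- which is orthogonal to a_(i+1).
          ≈⟨ +-cong (trans (pull (suc i) zero) (zeroʳ _)) (-‿cong (pull (suc i) (suc i))) ⟩
        0# - F (suc i) * diag u (suc i) (suc i)
          ≈⟨ +-identityˡ _ ⟩
        - (F (suc i) * diag u (suc i) (suc i))
          ≈⟨ -‿cong (trans (*-congˡ (reflexive (diag-diag u (suc i)))) (*-comm _ _)) ⟩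
        - (u (suc i) * F (suc i)) ∎

      translated : ∀ q l → F q * A l q + sum (λ i → block q l i * F (suc i)) ≈ gathered F q l
      -- The sum is already the tail of `(A · F) l`; only its head has the factors in the other
      -- order.
      translated zero    l = +-congʳ (*-comm _ _)
      translated (suc j) l = begin
        F (suc j) * A l (suc j) + sum (λ i → - diag (λ i → A l (suc i)) i j * F (suc i))
          ≈⟨ +-congˡ (trans
               (sum-cong-≋ λ i → sym (-‿distribˡ-* (diag (λ i → A l (suc i)) i j) (F (suc i))))
               (sum-neg λ i → diag (λ i → A l (suc i)) i j * F (suc i))) ⟩
        F (suc j) * A l (suc j) - sum (λ i → diag (λ i → A l (suc i)) i j * F (suc i))
          ≈⟨ +-congˡ (-‿cong (trans
               (sum-cong-≋ λ i → *-congʳ {F (suc i)} (reflexive (diag-sym (λ i → A l (suc i)) i j)))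
               (trans (diag-· (λ i → A l (suc i)) (λ i → F (suc i)) j) (*-comm _ _)))) ⟩
        F (suc j) * A l (suc j) - F (suc j) * A l (suc j)
          ≈⟨ -‿inverseʳ _ ⟩
        0# ∎

-- Squares and sums of nonnegative elements in an ordered field.

module OrderedFieldProperties (ℝ : CompleteOrderedField) where
  open CompleteOrderedField ℝ hiding (zero)
  open IsDecTotalOrder isDecTotalOrder using (antisym; total; ≤-respˡ-≈; ≤-respʳ-≈)
    renaming (_≟_ to _≈?_; trans to ≤-trans; refl to ≤-refl)
  open RingSolver commutativeRing
  open SemiringSum semiring using (sum)

  square-nonNeg : ∀ x → 0# ≤ x * x
  square-nonNeg x with total 0# x
  ... | inj₁ 0≤x = *-nonNeg 0≤x 0≤x
  ... | inj₂ x≤0 = ≤-respʳ-≈ (solve 1 (λ x → :- x :* :- x := x :* x) refl x) (*-nonNeg 0≤-x 0≤-x)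
    where
    0≤-x : 0# ≤ - x
    0≤-x = ≤-respˡ-≈ (-‿inverseʳ x) (≤-respʳ-≈ (+-identityˡ _) (+-monoˡ-≤ (- x) x≤0))

  +-nonNeg : ∀ {x y} → 0# ≤ x → 0# ≤ y → 0# ≤ x + y
  +-nonNeg {x} {y} 0≤x 0≤y = ≤-trans 0≤y (≤-respˡ-≈ (+-identityˡ y) (+-monoˡ-≤ y 0≤x))

  nonNeg-cancel : ∀ {x y} → 0# ≤ x → 0# ≤ y → x + y ≈ 0# → x ≈ 0#
  nonNeg-cancel {x} {y} 0≤x 0≤y x+y≈0 = antisym x≤0 0≤x
    where
    x≤0 : x ≤ 0#
    x≤0 = ≤-respʳ-≈ (trans (+-comm y x) x+y≈0) (≤-respˡ-≈ (+-identityˡ x) (+-monoˡ-≤ x 0≤y))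

  sum-nonNeg : ∀ {n} {f : Vector Carrier n} → (∀ i → 0# ≤ f i) → 0# ≤ sum f
  sum-nonNeg {ℕ.zero} 0≤f = ≤-refl
  sum-nonNeg {suc n}  0≤f = +-nonNeg (0≤f zero) (sum-nonNeg λ i → 0≤f (suc i))

  sum-nonNeg-cancel : ∀ {n} {f : Vector Carrier n} → (∀ i → 0# ≤ f i) → sum f ≈ 0# → ∀ i → f i ≈ 0#
  sum-nonNeg-cancel 0≤f ∑f≈0 zero =
    nonNeg-cancel (0≤f zero) (sum-nonNeg λ i → 0≤f (suc i)) ∑f≈0
  sum-nonNeg-cancel 0≤f ∑f≈0 (suc i) = sum-nonNeg-cancel (λ j → 0≤f (suc j))
    (nonNeg-cancel (sum-nonNeg λ j → 0≤f (suc j)) (0≤f zero) (trans (+-comm _ _) ∑f≈0)) i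

  square-cancel : ∀ {x} → x * x ≈ 0# → x ≈ 0#
  square-cancel {x} xx≈0 with x ≈? 0#
  ... | yes x≈0 = x≈0
  ... | no  x≉0 = let y , xy≈1 = inverse x x≉0 in
    trans (sym (trans (*-congˡ xy≈1) (*-identityʳ x)))
          (trans (sym (*-assoc x x y)) (trans (*-congʳ xx≈0) (zeroˡ y)))

-- The complex numbers as a commutative ring with conjugation.

module Complex (ℝ : CompleteOrderedField) where
  private module ℝ = CompleteOrderedField ℝ
  open IsDecTotalOrder ℝ.isDecTotalOrder using () renaming (_≟_ to _ℝ≟_)
  open Over ℝ
  open RingSolver ℝ.commutativeRing
  open RingProperties ℝ.ring using (+-cancelʳ; -0#≈0#; -‿involutive; -‿+-comm)
  open OrderedFieldProperties ℝ

  ℂ-commutativeRing : CommutativeRing 0ℓ 0ℓ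
  ℂ-commutativeRing = record
    { RawRing ℂ-rawRing
    ; isCommutativeRing = record
      { isRing = record
        { +-isAbelianGroup = record
          { isGroup = record
            { isMonoid = record
              { isSemigroup = record
                { isMagma = record
                  { isEquivalence = isEquivalence
                  ; ∙-cong        = λ (p , q) (r , s) → ℝ.+-cong p r , ℝ.+-cong q s
                  }
                ; assoc = λ _ _ _ → ℝ.+-assoc _ _ _ , ℝ.+-assoc _ _ _
                }
              ; identity = (λ _ → ℝ.+-identityˡ _ , ℝ.+-identityˡ _)
                         , (λ _ → ℝ.+-identityʳ _ , ℝ.+-identityʳ _)
              }
            ; inverse = (λ _ → ℝ.-‿inverseˡ _ , ℝ.-‿inverseˡ _)
                      , (λ _ → ℝ.-‿inverseʳ _ , ℝ.-‿inverseʳ _)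
            ; ⁻¹-cong = λ (p , q) → ℝ.-‿cong p , ℝ.-‿cong q
            }
          ; comm = λ _ _ → ℝ.+-comm _ _ , ℝ.+-comm _ _
          }
        ; *-cong     = *-cong
        ; *-assoc    = λ (a +i b) (c +i d) (e +i f) →
            solve 6 (λ a b c d e f →
              (a :* c :- b :* d) :* e :- (a :* d :+ b :* c) :* f
              := a :* (c :* e :- d :* f) :- b :* (c :* f :+ d :* e)) ℝ.refl a b c d e f ,
            solve 6 (λ a b c d e f →
              (a :* c :- b :* d) :* f :+ (a :* d :+ b :* c) :* e
              := a :* (c :* f :+ d :* e) :+ b :* (c :* e :- d :* f)) ℝ.refl a b c d e f
        ; *-identity = comm∧idˡ⇒id *-comm *-identityˡ
        ; distrib    = comm∧distrˡ⇒distr +-cong *-comm *-distribˡ-+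
        }
      ; *-comm = *-comm
      }
    }
    where
    isEquivalence : IsEquivalence _≈_
    isEquivalence = record
      { refl  = ℝ.refl , ℝ.refl
      ; sym   = λ (p , q) → ℝ.sym p , ℝ.sym q
      ; trans = λ (p , q) (r , s) → ℝ.trans p r , ℝ.trans q s
      }
    setoid : Setoid 0ℓ 0ℓ
    setoid = record { isEquivalence = isEquivalence }
    open Consequences setoid
    open Algebra.Definitions _≈_

    +-cong : Congruent₂ _+_
    +-cong (p , q) (r , s) = ℝ.+-cong p r , ℝ.+-cong q s

    *-cong : Congruent₂ _*_
    *-cong (p , q) (r , s) =
      ℝ.+-cong (ℝ.*-cong p r) (ℝ.-‿cong (ℝ.*-cong q s)) , ℝ.+-cong (ℝ.*-cong p s) (ℝ.*-cong q r)

    *-comm : Commutative _*_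
    *-comm (a +i b) (c +i d) =
      solve 4 (λ a b c d → a :* c :- b :* d := c :* a :- d :* b) ℝ.refl a b c d ,
      solve 4 (λ a b c d → a :* d :+ b :* c := c :* b :+ d :* a) ℝ.refl a b c d

    *-distribˡ-+ : _*_ DistributesOverˡ _+_
    *-distribˡ-+ (a +i b) (c +i d) (e +i f) =
      solve 6 (λ a b c d e f →
        a :* (c :+ e) :- b :* (d :+ f) := a :* c :- b :* d :+ (a :* e :- b :* f)) ℝ.refl a b c d e f ,
      solve 6 (λ a b c d e f →
        a :* (d :+ f) :+ b :* (c :+ e) := a :* d :+ b :* c :+ (a :* f :+ b :* e)) ℝ.refl a b c d e f

    *-identityˡ : LeftIdentity 1# _*_
    *-identityˡ (a +i b) =
      ℝ.trans (ℝ.+-cong (ℝ.*-identityˡ a) (ℝ.trans (ℝ.-‿cong (ℝ.zeroˡ b)) -0#≈0#)) (ℝ.+-identityʳ a) ,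
      ℝ.trans (ℝ.+-cong (ℝ.*-identityˡ b) (ℝ.zeroˡ a)) (ℝ.+-identityʳ b)

  conjugation : Conjugation ℂ-commutativeRing
  conjugation = record
    { conj               = conj
    ; isRingHomomorphism = record
      { isSemiringHomomorphism = record
        { isNearSemiringHomomorphism = record
          { +-isMonoidHomomorphism = record
            { isMagmaHomomorphism = record
              { isRelHomomorphism = record { cong = λ (p , q) → p , ℝ.-‿cong q }
              ; homo              = λ z w → ℝ.refl , ℝ.sym (-‿+-comm (im z) (im w))
              }
            ; ε-homo = ℝ.refl , -0#≈0#
            }
          ; *-homo = λ (a +i b) (c +i d) →
              solve 4 (λ a b c d → a :* c :- b :* d := a :* c :- :- b :* :- d) ℝ.refl a b c d ,
              solve 4 (λ a b c d → :- (a :* d :+ b :* c) := a :* :- d :+ :- b :* c) ℝ.refl a b c d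
          }
        ; 1#-homo = ℝ.refl , -0#≈0#
        }
      ; -‿homo = λ _ → ℝ.refl , ℝ.refl
      }
    ; conj-involutive = λ z → ℝ.refl , -‿involutive (im z)
    }

  module L = LinearAlgebra ℂ-commutativeRing conjugation
  private
    module C where
      open CommutativeRing ℂ-commutativeRing public
      open Sums +-commutativeMonoid public
      open SemiringSum semiring public
    module ∑ℝ where
      open Sums ℝ.+-commutativeMonoid public
      open SemiringSum ℝ.semiring public

  -- Squared norms of complex vectors.

  ∣∣²-cong : ∀ {z w} → z ≈ w → ∣ z ∣² ℝ.≈ ∣ w ∣²
  ∣∣²-cong (p , q) = ℝ.+-cong (ℝ.*-cong p p) (ℝ.*-cong q q)

  ∣0∣² : ∣ 0# ∣² ℝ.≈ ℝ.0#
  ∣0∣² = ℝ.trans (ℝ.+-cong (ℝ.zeroˡ _) (ℝ.zeroˡ _)) (ℝ.+-identityˡ _)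

  ‖‖²-cong : ∀ {n} {v w : Vector ℂ n} → (∀ i → v i ≈ w i) → ‖ v ‖² ℝ.≈ ‖ w ‖²
  ‖‖²-cong v≈w = ∑ℝ.sum-cong-≋ λ i → ∣∣²-cong (v≈w i)

  conj-*-self : ∀ z → conj z * z ≈ ∣ z ∣² +i ℝ.0#
  conj-*-self (a +i b) =
    solve 2 (λ a b → a :* a :- :- b :* b := a :* a :+ b :* b) ℝ.refl a b ,
    ℝ.trans (solve 2 (λ a b → a :* b :+ :- b :* a := a :* b :- a :* b) ℝ.refl a b) (ℝ.-‿inverseʳ _)

  -- Links the abstract linear algebra, which speaks of complex inner products, to the real norms in
  -- the definition of probability.
  ⟨v,v⟩≈‖v‖² : ∀ {n} (v : Vector ℂ n) → L.⟨ v , v ⟩ ≈ ‖ v ‖² +i ℝ.0#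
  ⟨v,v⟩≈‖v‖² {ℕ.zero} v = C.refl
  ⟨v,v⟩≈‖v‖² {suc n}  v = C.trans
    (C.+-cong (conj-*-self (v zero)) (⟨v,v⟩≈‖v‖² (λ i → v (suc i))))
    (ℝ.refl , ℝ.+-identityˡ _)

  ‖‖²-from-⟨⟩ : ∀ {m n} {v : Vector ℂ m} {w : Vector ℂ n} → L.⟨ v , v ⟩ ≈ L.⟨ w , w ⟩ → ‖ v ‖² ℝ.≈ ‖ w ‖²
  ‖‖²-from-⟨⟩ {v = v} {w} e = proj₁ (C.trans (C.sym (⟨v,v⟩≈‖v‖² v)) (C.trans e (⟨v,v⟩≈‖v‖² w)))

  -- A sum of squares in an ordered field vanishes only if every square does. This settles the
  -- columns of A whose norm has no reciprocal.
  ‖‖²-cancel : ∀ {n} {v : Vector ℂ n} → ‖ v ‖² ℝ.≈ ℝ.0# → ∀ i → v i ≈ 0#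
  ‖‖²-cancel {v = v} ‖v‖²≈0 i =
    square-cancel (nonNeg-cancel (square-nonNeg (re (v i))) (square-nonNeg (im (v i))) ∣vᵢ∣²≈0) ,
    square-cancel (nonNeg-cancel (square-nonNeg (im (v i))) (square-nonNeg (re (v i)))
                                 (ℝ.trans (ℝ.+-comm _ _) ∣vᵢ∣²≈0))
    where
    ∣vᵢ∣²≈0 : ∣ v i ∣² ℝ.≈ ℝ.0#
    ∣vᵢ∣²≈0 = sum-nonNeg-cancel {f = λ j → ∣ v j ∣²}
      (λ j → +-nonNeg (square-nonNeg (re (v j))) (square-nonNeg (im (v j)))) ‖v‖²≈0 i

  -- Unitary evolution and total probability.

  diag-unitary : ∀ {n} (u : Vector ℂ n) → (∀ i → conj (u i) * u i ≈ 1#) → IsUnitary (diag u)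
  diag-unitary u ∣u∣²≈1 = record
    { †-inverseˡ = λ i j → C.trans (C.sum-cong-≋ λ k → C.*-congʳ {diag u k j} (L.diag-† u i k))
        (C.trans (L.diag-⊡ (λ i → conj (u i)) u i j) (L.diag-cong ∣u∣²≈1 i j))
    ; †-inverseʳ = λ i j → C.trans (C.sum-cong-≋ λ k → C.*-congˡ {diag u i k} (L.diag-† u k j))
        (C.trans (L.diag-⊡ u (λ i → conj (u i)) i j)
                 (L.diag-cong (λ i → C.trans (C.*-comm _ _) (∣u∣²≈1 i)) i j))
    }

  conj-1*1≈1 : conj 1# * 1# ≈ 1#
  conj-1*1≈1 = C.trans (C.*-identityʳ (conj 1#)) (Conjugation.conj-1# conjugation)

  ∣F⟩-phase : ∀ {n} (x : BitString n) i → conj (∣F⟩ x i) * ∣F⟩ x i ≈ 1#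
  ∣F⟩-phase x zero = conj-1*1≈1
  ∣F⟩-phase x (suc i) with lookup x i
  ... | true  = C.trans (L.conj-neg-* 1# 1#) conj-1*1≈1
  ... | false = conj-1*1≈1

  -- Stated for every ψ, not only for unit vectors: besides total probability, it yields the norm of
  -- an initial state from that of the final state.
  evolution-isometry : ∀ {n m} {U₀ U₁ : Matrix (suc n ℕ.* m) (suc n ℕ.* m)} →
    IsUnitary U₀ → IsUnitary U₁ → ∀ x ψ → ‖ U₁ · oracle {n} m x · U₀ · ψ ‖² ℝ.≈ ‖ ψ ‖²
  evolution-isometry {n} {m} {U₀} {U₁} unitary₀ unitary₁ x ψ = ℝ.trans
    (preserves unitary₁ (oracle {n} m x · U₀ · ψ))
    (ℝ.trans (preserves (diag-unitary _ (λ k → ∣F⟩-phase {n} x (quotient m k))) (U₀ · ψ))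
             (preserves unitary₀ ψ))
    where
    preserves : ∀ {d} {U : Matrix d d} → IsUnitary U → ∀ v → ‖ U · v ‖² ℝ.≈ ‖ v ‖²
    preserves {U = U} unitary v =
      ‖‖²-from-⟨⟩ {v = U · v} {v} (L.isometry {U = U} (IsUnitary.†-inverseˡ unitary) v v)

  module Measurement {n} {P : Bool → Matrix n n} (P-measurement : IsProjectiveMeasurement P) where
    open IsProjectiveMeasurement P-measurement

    resolve : ∀ v w → L.⟨ P true · v , P true · w ⟩ + L.⟨ P false · v , P false · w ⟩ ≈ L.⟨ v , w ⟩
    resolve = L.measurement {P = P true} {P false}
      (hermitian true) (idempotent true) (hermitian false) (idempotent false)
      (λ i j → C.trans (C.+-comm (P true i j) (P false i j)) (complete i j))

    total : ∀ v → ‖ P true · v ‖² ℝ.+ ‖ P false · v ‖² ℝ.≈ ‖ v ‖²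
    total v = proj₁ (C.trans
      (C.+-cong (C.sym (⟨v,v⟩≈‖v‖² (P true · v))) (C.sym (⟨v,v⟩≈‖v‖² (P false · v))))
      (C.trans (resolve v v) (⟨v,v⟩≈‖v‖² v)))

  total-probability : ∀ {n} (𝒜 : OneQueryAlgorithm n) x →
    let open OneQueryAlgorithm 𝒜 in probability x true ℝ.+ probability x false ℝ.≈ ℝ.1#
  total-probability 𝒜 x = ℝ.trans (Measurement.total P-measurement (final x))
    (ℝ.trans (evolution-isometry {m = workDim} U₀-unitary U₁-unitary x initial) initial-unit)
    where open OneQueryAlgorithm 𝒜

  summand-of-one : ∀ {a b} → a ℝ.+ b ℝ.≈ ℝ.1# → b ℝ.≈ ℝ.1# → a ℝ.≈ ℝ.0#
  summand-of-one {a} {b} a+b≈1 b≈1 = +-cancelʳ b a ℝ.0#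
    (ℝ.trans a+b≈1 (ℝ.trans (ℝ.sym b≈1) (ℝ.sym (ℝ.+-identityˡ b))))

  -- From an algorithm to a matrix with orthogonal columns.

  module AlgorithmToMatrix {n} (𝒜 : OneQueryAlgorithm n) where
    open OneQueryAlgorithm 𝒜

    φ : Vector ℂ dim
    φ = U₀ · initial

    Φ : Matrix dim (suc n)
    Φ = L.spread {suc n} {workDim} φ

    B : Matrix dim (suc n)
    B = U₁ ⊡ Φ

    -- The accepting half comes first, because the first p rows have to represent f; here p = q =
    -- `dim`.
    A : Matrix (dim ℕ.+ dim) (suc n)
    A = (P true ⊡ B) ++ (P false ⊡ B)

    -- The oracle is diagonal, so its phases and the amplitudes φ may exchange roles: the oracle
    -- applied to φ equals `Φ` applied to `∣F⟩ x`. The input then enters only through the vector.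
    B-final : ∀ x k → (B · ∣F⟩ x) k ≈ final x k
    B-final x k = C.trans (L.·-assoc U₁ Φ (∣F⟩ x) k) (L.·-congˡ U₁ (λ j → C.trans
      (L.spread-· {suc n} {workDim} φ (∣F⟩ x) j)
      (C.trans (C.*-comm (φ j) (∣F⟩ x (quotient workDim j)))
               (C.sym (L.diag-· (λ k → ∣F⟩ x (quotient workDim k)) φ j)))) k)

    PB-final : ∀ b x k → ((P b ⊡ B) · ∣F⟩ x) k ≈ (P b · final x) k
    PB-final b x k = C.trans (L.·-assoc (P b) B (∣F⟩ x) k) (L.·-congˡ (P b) (B-final x) k)

    rows-true : ∀ x → ∑ℝ (λ (l : Fin dim) → ∣ (A · ∣F⟩ x) (l ↑ˡ dim) ∣²) ℝ.≈ probability x true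
    rows-true x = ∑ℝ.sum-cong-≋ λ l → ∣∣²-cong (C.trans
      (C.reflexive (≡.cong (λ a → ∑ℂ (λ i → a i * ∣F⟩ x i)) (lookup-++ˡ (P true ⊡ B) (P false ⊡ B) l)))
      (PB-final true x l))

    rows-false : ∀ x → ∑ℝ (λ l → ∣ (A · ∣F⟩ x) (dim ↑ʳ l) ∣²) ℝ.≈ probability x false
    rows-false x = ∑ℝ.sum-cong-≋ λ l → ∣∣²-cong (C.trans
      (C.reflexive (≡.cong (λ a → ∑ℂ (λ i → a i * ∣F⟩ x i)) (lookup-++ʳ (P true ⊡ B) (P false ⊡ B) l)))
      (PB-final false x l))

    normalised : ∀ x → ‖ A · ∣F⟩ x ‖² ℝ.≈ ℝ.1#
    normalised x = ℝ.trans (∑ℝ.sum-++ dim (λ l → ∣ (A · ∣F⟩ x) l ∣²))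
      (ℝ.trans (ℝ.+-cong (rows-true x) (rows-false x)) (total-probability 𝒜 x))

    -- The measurement and `U₁` preserve inner products, so the columns of `A` inherit the
    -- orthogonality of the columns of `Φ`.
    gram : A † ⊡ A ≋ diag (λ i → L.⟨ L.column A i , L.column A i ⟩)
    gram = L.gram-diagonal A λ {i} {j} i≢j → C.trans
      (L.⟨⟩-++ (P true ⊡ B) (P false ⊡ B) i j)
      (C.trans (Measurement.resolve P-measurement (L.column B i) (L.column B j))
        (C.trans (L.isometry {U = U₁} (IsUnitary.†-inverseˡ U₁-unitary) (L.column Φ i) (L.column Φ j))
                 (L.spread-orthogonal {suc n} {workDim} φ i≢j)))

    represents : (f : PartialBooleanFunction n) → ComputesExactly f 𝒜 → IsSOSRepresentation f dim dim A
    represents f exact = record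
      { represents = λ x x∈D → ℝ.trans (rows-true x) (value-true x (value x x∈D) (exact x x∈D))
      ; normalised = normalised
      }
      where
      open PartialBooleanFunction f
      value-true : ∀ x b → probability x b ℝ.≈ ℝ.1# →
                   probability x true ℝ.≈ (if b then ℝ.1# else ℝ.0#)
      value-true x true  p = p
      -- If the outcome is surely false, total probability leaves 0 for true.
      value-true x false p = summand-of-one (total-probability 𝒜 x) p

  -- From a matrix with orthogonal columns to an algorithm.

  module MatrixToAlgorithm {n p q} (A : Matrix (p ℕ.+ q) (suc n)) (u : Vector ℂ (suc n))
                           (gram : A † ⊡ A ≋ diag u)
                           (normalised : ∀ x → ‖ A · ∣F⟩ x ‖² ℝ.≈ ℝ.1#) where

    workDim dim : ℕ
    workDim = p ℕ.+ q
    dim = suc n ℕ.* workDim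

    -- The diagonal of `gram` shows that u, given as complex numbers, is real.
    u≈‖column‖² : ∀ i → u i ≈ ‖ L.column A i ‖² +i ℝ.0#
    u≈‖column‖² i = C.trans (C.sym (C.trans (gram i i) (C.reflexive (L.diag-diag u i))))
                            (⟨v,v⟩≈‖v‖² (L.column A i))

    -- For a nonzero column c is the reciprocal of its squared norm, taken in ℝ so that conjugation
    -- fixes it. For a zero column both sides of the equation vanish, and c = 0 is a default.
    reciprocal : ∀ i → Σ[ c ∈ ℂ ] conj c ≈ c × (∀ l → A l i * (c * u i) ≈ A l i)
    reciprocal i with ‖ L.column A i ‖² ℝ≟ ℝ.0#
    ... | yes aᵢ≈0 = 0# , Conjugation.conj-0# conjugation ,
          λ l → C.trans (C.*-congʳ (column≈0 l)) (C.trans (C.zeroˡ _) (C.sym (column≈0 l)))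
      where
      column≈0 : ∀ l → A l i ≈ 0#
      column≈0 = ‖‖²-cancel {v = L.column A i} aᵢ≈0
    ... | no aᵢ≉0 with y , ‖aᵢ‖²y≈1 ← ℝ.inverse _ aᵢ≉0 =
          y +i ℝ.0# , (ℝ.refl , -0#≈0#) ,
          λ l → C.trans (C.*-congˡ {A l i} yu≈1) (C.*-identityʳ (A l i))
      where
      yu≈1 : (y +i ℝ.0#) * u i ≈ 1#
      yu≈1 = C.trans (C.*-congˡ {y +i ℝ.0#} (u≈‖column‖² i))
        ( ℝ.trans (ℝ.+-cong (ℝ.trans (ℝ.*-comm _ _) ‖aᵢ‖²y≈1) (ℝ.trans (ℝ.-‿cong (ℝ.zeroˡ _)) -0#≈0#))
                  (ℝ.+-identityʳ _)
        , ℝ.trans (ℝ.+-cong (ℝ.zeroʳ _) (ℝ.zeroˡ _)) (ℝ.+-identityʳ _))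

    module G = L.Gather A u (λ i → proj₁ (reciprocal i)) (λ i → proj₁ (proj₂ (reciprocal i)))
                        gram (λ l i → proj₂ (proj₂ (reciprocal i)) l)

    initial : Vector ℂ dim
    initial = C.flatten (λ i l → A l i)

    gathers : ∀ x k → (G.H · oracle {n} workDim x · 𝟙 · initial) k ≈ C.flatten (G.gathered (∣F⟩ x)) k
    gathers x k = C.trans
      (L.·-congˡ G.H (λ j → C.trans
        (L.diag-· (λ k → ∣F⟩ x (quotient workDim k)) (𝟙 · initial) j)
        (C.*-congˡ {∣F⟩ x (quotient workDim j)} (L.𝟙-· initial j))) k)
      (G.H-gathers (∣F⟩ x) k)

    ‖flatten‖² : ∀ (g : Fin (suc n) → Fin workDim → ℂ) → (∀ i l → g (suc i) l ≈ 0#) →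
                 ‖ C.flatten g ‖² ℝ.≈ ‖ g zero ‖²
    ‖flatten‖² g g≈0 = ℝ.trans (∑ℝ.sum-flatten (λ i l → ∣ g i l ∣²)) (ℝ.trans
      (ℝ.+-congˡ (∑ℝ.sum-0 (λ i → ∑ℝ.sum-0 (λ l → ℝ.trans (∣∣²-cong (g≈0 i l)) ∣0∣²))))
      (ℝ.+-identityʳ _))

    unitary-𝟙 : IsUnitary {dim} 𝟙
    unitary-𝟙 = diag-unitary (λ _ → 1#) (λ _ → conj-1*1≈1)

    unitary-H : IsUnitary G.H
    unitary-H = record { †-inverseˡ = G.H†⊡H ; †-inverseʳ = G.H⊡H† }

    initial-unit : ‖ initial ‖² ℝ.≈ ℝ.1#
    initial-unit = ℝ.trans
      (ℝ.sym (evolution-isometry {m = workDim} unitary-𝟙 unitary-H x initial))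
      (ℝ.trans (‖‖²-cong (gathers x))
        (ℝ.trans (‖flatten‖² (G.gathered (∣F⟩ x)) (λ _ _ → C.refl)) (normalised x)))
      where
      x : BitString n
      -- Any input serves, inside the domain or not, since `normalised` holds for all bit strings.
      x = replicate n false

    side : Fin workDim → Bool
    side l = [ (λ _ → true) , (λ _ → false) ] (splitAt p l)

    indicator : Bool → Bool → ℂ
    indicator true  b = if b then 1# else 0#
    indicator false b = if b then 0# else 1#

    -- The outcome is read off the row index in every block alike. This gives complete projections
    -- on the whole space, although the final state lies in block 0.
    χ : Bool → Vector ℂ dim
    χ b k = indicator b (side (remainder {suc n} workDim k))

    measurement : IsProjectiveMeasurement (λ b → diag (χ b))
    measurement = record
      { hermitian  = λ b i j → C.trans (L.diag-† (χ b) i j)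
          (L.diag-cong (λ k → real b (side (remainder {suc n} workDim k))) i j)
      ; idempotent = λ b i j → C.trans (L.diag-⊡ (χ b) (χ b) i j)
          (L.diag-cong (λ k → square b (side (remainder {suc n} workDim k))) i j)
      ; orthogonal = λ {b} {c} b≢c i j → C.trans (L.diag-⊡ (χ b) (χ c) i j)
          (C.trans (L.diag-cong (λ k → product b≢c (side (remainder {suc n} workDim k))) i j)
                   (diag-0 i j))
      ; complete   = complete
      }
      where
      real : ∀ b s → conj (indicator b s) ≈ indicator b s
      real true  true  = Conjugation.conj-1# conjugation
      real true  false = Conjugation.conj-0# conjugation
      real false true  = Conjugation.conj-0# conjugation
      real false false = Conjugation.conj-1# conjugation

      square : ∀ b s → indicator b s * indicator b s ≈ indicator b s
      square true  true  = C.*-identityˡ _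
      square true  false = C.zeroˡ _
      square false true  = C.zeroˡ _
      square false false = C.*-identityˡ _

      product : ∀ {b c} → b ≢ c → ∀ s → indicator b s * indicator c s ≈ 0#
      product {true}  {true}  b≢c s     = contradiction ≡.refl b≢c
      product {true}  {false} b≢c true  = C.zeroʳ _
      product {true}  {false} b≢c false = C.zeroˡ _
      product {false} {true}  b≢c true  = C.zeroˡ _
      product {false} {true}  b≢c false = C.zeroʳ _
      product {false} {false} b≢c s     = contradiction ≡.refl b≢c

      diag-0 : diag {dim} (λ _ → 0#) ≋ 𝟘
      diag-0 i j with does (i ≟ j)
      ... | true  = C.refl
      ... | false = C.refl

      sum-to-1 : ∀ s → indicator false s + indicator true s ≈ 1#
      sum-to-1 true  = C.+-identityˡ _
      sum-to-1 false = C.+-identityʳ _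

      complete : diag (χ false) ⊕ diag (χ true) ≋ 𝟙
      complete i j with does (i ≟ j)
      ... | true  = sum-to-1 (side (remainder {suc n} workDim i))
      ... | false = C.+-identityˡ _

    algorithm : OneQueryAlgorithm n
    algorithm = record
      { workDim       = workDim
      ; initial       = initial
      ; initial-unit  = initial-unit
      ; U₀            = 𝟙
      ; U₁            = G.H
      ; U₀-unitary    = unitary-𝟙
      ; U₁-unitary    = unitary-H
      ; P             = λ b → diag (χ b)
      ; P-measurement = measurement
      }

    open OneQueryAlgorithm algorithm using (final; probability)

    -- The final state is A F(x) in block 0 and zero in all other blocks, and the projection for
    -- true erases the last q rows.
    probability-true : ∀ x → probability x true ℝ.≈ ∑ℝ (λ (l : Fin p) → ∣ (A · ∣F⟩ x) (l ↑ˡ q) ∣²)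
    probability-true x = begin
      ‖ diag (χ true) · final x ‖²
        ≈⟨ ‖‖²-cong (λ k → C.trans (L.diag-· (χ true) (final x) k) (C.*-congˡ {χ true k} (gathers x k))) ⟩
      ‖ C.flatten (λ i l → indicator true (side l) * G.gathered (∣F⟩ x) i l) ‖²
        ≈⟨ ‖flatten‖² (λ i l → indicator true (side l) * G.gathered (∣F⟩ x) i l) (λ i l → C.zeroʳ (indicator true (side l))) ⟩
      ∑ℝ (λ l → ∣ indicator true (side l) * (A · ∣F⟩ x) l ∣²)
        ≈⟨ ∑ℝ.sum-++ p (λ l → ∣ indicator true (side l) * (A · ∣F⟩ x) l ∣²) ⟩
      ∑ℝ (λ (l : Fin p) → ∣ indicator true (side (l ↑ˡ q)) * (A · ∣F⟩ x) (l ↑ˡ q) ∣²)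
        ℝ.+ ∑ℝ (λ (l : Fin q) → ∣ indicator true (side (p ↑ʳ l)) * (A · ∣F⟩ x) (p ↑ʳ l) ∣²)
        ≈⟨ ℝ.+-cong (∑ℝ.sum-cong-≋ λ l → ∣∣²-cong (upper l)) (∑ℝ.sum-0 lower) ⟩
      ∑ℝ (λ (l : Fin p) → ∣ (A · ∣F⟩ x) (l ↑ˡ q) ∣²) ℝ.+ ℝ.0#
        ≈⟨ ℝ.+-identityʳ _ ⟩
      ∑ℝ (λ (l : Fin p) → ∣ (A · ∣F⟩ x) (l ↑ˡ q) ∣²) ∎
      where
      open SetoidReasoning ℝ.setoid
      upper : ∀ l → indicator true (side (l ↑ˡ q)) * (A · ∣F⟩ x) (l ↑ˡ q) ≈ (A · ∣F⟩ x) (l ↑ˡ q)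
      upper l rewrite splitAt-↑ˡ p l q = C.*-identityˡ _

      lower : ∀ l → ∣ indicator true (side (p ↑ʳ l)) * (A · ∣F⟩ x) (p ↑ʳ l) ∣² ℝ.≈ ℝ.0#
      lower l rewrite splitAt-↑ʳ p q l = ℝ.trans (∣∣²-cong (C.zeroˡ ((A · ∣F⟩ x) (p ↑ʳ l)))) ∣0∣²

    computesExactly : ∀ (f : PartialBooleanFunction n) → let open PartialBooleanFunction f in
      (∀ x (x∈D : x ∈ domain) → ∑ℝ (λ (l : Fin p) → ∣ (A · ∣F⟩ x) (l ↑ˡ q) ∣²)
                                  ℝ.≈ (if value x x∈D then ℝ.1# else ℝ.0#)) →
      ComputesExactly f algorithm
    computesExactly f represents x x∈D =
      value-probability (value x x∈D) (ℝ.trans (probability-true x) (represents x x∈D))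
      where
      open PartialBooleanFunction f
      value-probability : ∀ b → probability x true ℝ.≈ (if b then ℝ.1# else ℝ.0#) → probability x b ℝ.≈ ℝ.1#
      value-probability true  e = e
      -- Adds `probability x true`, which is 0 here, so that total probability applies.
      value-probability false e = ℝ.trans (ℝ.sym (ℝ.+-identityˡ _))
        (ℝ.trans (ℝ.+-congʳ (ℝ.sym e)) (total-probability algorithm x))

open import Data.Nat using (_+_)

theorem3 : (ℝ : CompleteOrderedField) → let open Over ℝ hiding (_+_) in
    (n : ℕ) (f : PartialBooleanFunction n) → NonConstant f →
    (Σ[ 𝒜 ∈ OneQueryAlgorithm n ] ComputesExactly f 𝒜)
    ⇔
    (∃[ p ] ∃[ q ] Σ[ A ∈ Matrix (p + q) (suc n) ]
    (IsSOSRepresentation f p q A ×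
    (Σ[ u ∈ Vector ℂ (suc n) ] A † ⊡ A ≋ diag u)))
theorem3 ℝ n f _ = mk⇔
  (λ (𝒜 , exact) → let open AlgorithmToMatrix 𝒜 in
    -- The underscore is solved from the type of `gram`: u consists of the inner products of the
    -- columns with themselves.
    dim 𝒜 , dim 𝒜 , A , represents f exact , _ , gram)
  (λ (p , q , A , rep , u , gram) →
    let open Over.IsSOSRepresentation rep
        open MatrixToAlgorithm {p = p} {q} A u gram normalised
    in algorithm , computesExactly f represents)
  where
  open Complex ℝ
  open Over ℝ using (module OneQueryAlgorithm)
  open OneQueryAlgorithm using (dim)
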